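{- Let $r\in\mathbb{Q}$ be such that there exist $a\in\mathbb{Z}$ and $b\in\mathbb{N}$ with $\gcd(a,b)=1$ and $S(a,b)=r$. Then there exists a sequence of pairs $(a_i,b_i)$, $i\in\mathbb{N}$, with $a_i\in\mathbb{Z}$, $b_i\in\mathbb{N}$, $\gcd(a_i,b_i)=1$, such that $b_i\to\infty$ as $i\to\infty$ and $S(a_i,b_i)=r$ for all $i\in\mathbb{N}$.
   Context: For $a\in\mathbb{Z}$, $b\in\mathbb{N}$ with $\gcd(a,b)=1$, the Dedekind sum is $s(a,b)=\sum_{k=1}^{b}((k/b))((ak/b))$, where for real $x$, $((x))=x-\lfloor x\rfloor-1/2$ if $x\notin\mathbb{Z}$ and $((x))=0$ if $x\in\mathbb{Z}$. The normalized Dedekind sum is $S(a,b)=12\,s(a,b)$. -}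

module Defs where

open import Data.Nat as ℕ using (ℕ; zero; suc; NonZero)
open import Data.Integer as ℤ using (ℤ; +_)
open import Data.Rational using (ℚ; _/_; _+_; _-_; _*_; ½; floor; ↧ₙ_; 0ℚ; 1ℚ)
import Data.Rational as Q
open import Relation.Nullary using (yes; no)

-- ((x)) : the sawtooth function on ℚ.
-- x ∈ ℤ  iff its reduced denominator is 1; then ((x)) = 0,
-- otherwise ((x)) = x - ⌊x⌋ - 1/2.
saw : ℚ → ℚ
saw x with ↧ₙ x ℕ.≟ 1
... | yes _ = 0ℚ
... | no  _ = x - (floor x / 1) - ½

sum1 : ℕ → (ℕ → ℚ) → ℚ
sum1 zero    f = 0ℚ
sum1 (suc n) f = sum1 n f + f (suc n)

s : ℤ → (b : ℕ) → .{{NonZero b}} → ℚ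
s a b = sum1 b (λ k → saw ((+ k) / b) * saw ((a ℤ.* + k) / b))

S : ℤ → (b : ℕ) → .{{NonZero b}} → ℚ
S a b = (+ 12 / 1) * s a b

{-# OPTIONS --safe #-}
-- Put n = i b and L = 1 + n². Then S(a L - n, b L) = S(a, b) for every i ∈ ℕ, while b L → ∞.
-- With c(z) = 2 (z mod b) - b + 1, which sums to 0 over any residue system, and E(a, b) = Σ_k c(k) c(a k),
-- one has 4 b² s(a, b) = E(a, b) + b - b², so the claim is E(a L - n, b L) = L² E(a, b) + b (L² - L).
-- Writing the summation index as j L + t, both factors split into a multiple of L and a remainder in t:
-- their products with a remainder cancel or give E(- n, L) = L² - L (as n² ≡ -1 mod L), and among the
-- products without remainder those with t ≠ n² run through complete residue systems and cancel (as b ∣ n),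
-- so that t = n² contributes L² E(a, b).

module Submission where

open import Defs
open import Data.Nat using (ℕ; NonZero; _≤_)
open import Data.Integer using (ℤ; +_; 1ℤ)
open import Data.Integer.GCD using (gcd)
open import Data.Rational using (ℚ)
open import Data.Product using (Σ; _×_; ∃; _,_)
open import Relation.Binary.PropositionalEquality using (_≡_)

open import Data.Nat as ℕ using (zero; suc; _<_; s≤s; z≤n)
import Data.Nat.Properties as ℕ
import Data.Nat.Divisibility as ℕ
import Data.Nat.GCD as ℕ using (module Bézout)
open import Data.Nat.Coprimality using (coprime-Bézout; gcd≡1⇒coprime)
open import Data.Integer as ℤ using (0ℤ; -1ℤ; -[1+_]; _+_; _*_; _-_; -_; ∣_∣; _%ℕ_; _/ℕ_)
import Data.Integer.Properties as ℤ
open import Data.Integer.DivMod using (a≡a%ℕn+[a/ℕn]*n; n%ℕd<d; div-pos-is-/ℕ)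
open import Data.Integer.Divisibility.Signed using (_∣_; ∣ᵤ⇒∣; ∣⇒∣ᵤ; ∣m∣n⇒∣m+n; ∣m⇒∣m*n; ∣n⇒∣m*n)
open import Data.Integer.GCD using (gcd[i,j]∣i; gcd[i,j]∣j)
open import Data.Integer.Tactic.RingSolver using (solve-∀)
open import Data.Rational using (mkℚ; _/_; ½; floor; ↥_; ↧_; ↧ₙ_; 0ℚ; 1ℚ; toℚᵘ)
import Data.Rational as Q
import Data.Rational.Properties as Q
open import Data.Rational.Solver using (module +-*-Solver)
open import Data.Rational.Unnormalised using (mkℚᵘ; *≡*) renaming (_≃_ to _≃ᵘ_)
import Data.Rational.Unnormalised.Properties as ℚᵘ
open import Algebra.Properties.AbelianGroup ℤ.+-0-abelianGroup using () renaming (∙-cancelˡ to +-cancelˡ)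
open import Data.Product using (∃₂; proj₁; proj₂)
open import Function using (_∘_)
open import Relation.Binary.PropositionalEquality
  using (_≢_; refl; sym; trans; cong; cong₂; subst; module ≡-Reasoning)
open import Relation.Nullary using (contradiction; yes; no)
open ≡-Reasoning

-- Finite sums of integers.

∑ : ℕ → (ℕ → ℤ) → ℤ
∑ zero    f = 0ℤ
∑ (suc n) f = ∑ n f + f n

∑-cong : ∀ n {f g : ℕ → ℤ} → (∀ k → k < n → f k ≡ g k) → ∑ n f ≡ ∑ n g
∑-cong zero    eq = refl
∑-cong (suc n) eq =
  cong₂ _+_ (∑-cong n λ k k<n → eq k (ℕ.m<n⇒m<1+n k<n)) (eq n ℕ.≤-refl)

∑-ext : ∀ n {f g : ℕ → ℤ} → (∀ k → f k ≡ g k) → ∑ n f ≡ ∑ n g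
∑-ext n eq = ∑-cong n λ k _ → eq k

∑-const : ∀ n z → ∑ n (λ _ → z) ≡ + n * z
∑-const zero    z = sym (ℤ.*-zeroˡ z)
∑-const (suc n) z = begin
  ∑ n (λ _ → z) + z  ≡⟨ cong (_+ z) (∑-const n z) ⟩
  + n * z + z        ≡⟨ ℤ.+-comm (+ n * z) z ⟩
  z + + n * z        ≡⟨ ℤ.suc-* (+ n) z ⟨
  + suc n * z        ∎

∑-0 : ∀ n → ∑ n (λ _ → 0ℤ) ≡ 0ℤ
∑-0 n = trans (∑-const n 0ℤ) (ℤ.*-zeroʳ (+ n))

∑-+ : ∀ n f g → ∑ n (λ k → f k + g k) ≡ ∑ n f + ∑ n g
∑-+ zero    f g = refl
∑-+ (suc n) f g = trans (cong (_+ (f n + g n)) (∑-+ n f g)) (lemma (∑ n f) (∑ n g) (f n) (g n))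
  where
  lemma : ∀ w x y z → w + x + (y + z) ≡ w + y + (x + z)
  lemma = solve-∀

∑-* : ∀ n z f → ∑ n (λ k → z * f k) ≡ z * ∑ n f
∑-* zero    z f = sym (ℤ.*-zeroʳ z)
∑-* (suc n) z f = trans (cong (_+ z * f n) (∑-* n z f)) (sym (ℤ.*-distribˡ-+ z (∑ n f) (f n)))

∑-swap : ∀ m n (f : ℕ → ℕ → ℤ) → ∑ m (λ j → ∑ n (f j)) ≡ ∑ n (λ k → ∑ m (λ j → f j k))
∑-swap zero    n f = sym (∑-0 n)
∑-swap (suc m) n f =
  trans (cong (_+ ∑ n (f m)) (∑-swap m n f)) (sym (∑-+ n (λ k → ∑ m (λ j → f j k)) (f m)))

∑-++ : ∀ m n f → ∑ (m ℕ.+ n) f ≡ ∑ m f + ∑ n (λ k → f (m ℕ.+ k))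
∑-++ m zero    f rewrite ℕ.+-identityʳ m = sym (ℤ.+-identityʳ (∑ m f))
∑-++ m (suc n) f rewrite ℕ.+-suc m n =
  trans (cong (_+ f (m ℕ.+ n)) (∑-++ m n f)) (ℤ.+-assoc (∑ m f) _ _)

∑-head : ∀ n f → ∑ (suc n) f ≡ f 0 + ∑ n (f ∘ suc)
∑-head n f = trans (∑-++ 1 n f) (cong (_+ ∑ n (f ∘ suc)) (ℤ.+-identityˡ (f 0)))

∑-blocks : ∀ m n f → ∑ (m ℕ.* n) f ≡ ∑ m (λ j → ∑ n (λ t → f (j ℕ.* n ℕ.+ t)))
∑-blocks zero    n f = refl
∑-blocks (suc m) n f = begin
  ∑ (n ℕ.+ m ℕ.* n) f                              ≡⟨ cong (λ k → ∑ k f) (ℕ.+-comm n (m ℕ.* n)) ⟩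
  ∑ (m ℕ.* n ℕ.+ n) f                              ≡⟨ ∑-++ (m ℕ.* n) n f ⟩
  ∑ (m ℕ.* n) f + ∑ n (λ t → f (m ℕ.* n ℕ.+ t))    ≡⟨ cong (_+ ∑ n (λ t → f (m ℕ.* n ℕ.+ t))) (∑-blocks m n f) ⟩
  ∑ (suc m) (λ j → ∑ n (λ t → f (j ℕ.* n ℕ.+ t)))  ∎

-- Periodic functions and their sums over residue systems.

Periodic : ℤ → (ℤ → ℤ) → Set
Periodic p f = ∀ z → f (z + p) ≡ f z

periodic-neg : ∀ {p f} → Periodic p f → Periodic (- p) f
periodic-neg {p} {f} per z = trans (sym (per (z - p))) (cong f (lemma z p))
  where
  lemma : ∀ z p → z - p + p ≡ z
  lemma = solve-∀

periodic-+ : ∀ {p q f} → Periodic p f → Periodic q f → Periodic (p + q) f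
periodic-+ {p} {q} {f} per per′ z =
  trans (cong f (sym (ℤ.+-assoc z p q))) (trans (per′ (z + p)) (per z))

periodic-*ℕ : ∀ {p f} k → Periodic p f → Periodic (+ k * p) f
periodic-*ℕ {p} {f} zero    per z = cong f (trans (cong (_+_ z) (ℤ.*-zeroˡ p)) (ℤ.+-identityʳ z))
periodic-*ℕ {p} {f} (suc k) per =
  subst (λ q → Periodic q f) (sym (ℤ.suc-* (+ k) p)) (periodic-+ {p} per (periodic-*ℕ k per))

periodic-* : ∀ {p f} k → Periodic p f → Periodic (k * p) f
periodic-* (+ k) per = periodic-*ℕ k per
periodic-* {p} {f} -[1+ k ] per =
  subst (λ q → Periodic q f) (ℤ.neg-distribˡ-* (+ suc k) p)
    (periodic-neg {+ suc k * p} (periodic-*ℕ (suc k) per))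

periodic-1 : ∀ {f} → Periodic 1ℤ f → ∀ y z → f y ≡ f z
periodic-1 {f} per y z =
  trans (cong f (lemma y z)) (periodic-* {1ℤ} (y - z) per z)
  where
  lemma : ∀ y z → y ≡ z + (y - z) * 1ℤ
  lemma = solve-∀

-- Coprimality in Bézout form: the inverse `d` and the quotient `x` are kept as data, so that later
-- identities can use them in ring calculations.
Inverse : ℤ → ℕ → Set
Inverse a b = ∃₂ λ d x → a * d ≡ 1ℤ + x * + b

inverse-1 : ∀ {b} → Inverse 1ℤ b
inverse-1 = 1ℤ , 0ℤ , refl

inverse-neg-1 : ∀ {b} → Inverse -1ℤ b
inverse-neg-1 = -1ℤ , 0ℤ , refl

-- H z = Σ_j f(a j + z) has period a, by shifting j, and period b; as a is a unit modulo b, it is constant.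
∑-affine-const : ∀ b {f} → Periodic (+ b) f → ∀ a → Inverse a b →
  ∀ y z → ∑ b (λ j → f (a * + j + y)) ≡ ∑ b (λ j → f (a * + j + z))
∑-affine-const b {f} per a (d , x , inv) = periodic-1 per-1
  where
  H : ℤ → ℤ
  H z = ∑ b (λ j → f (a * + j + z))

  per-b : Periodic (+ b) H
  per-b z = ∑-ext b λ j → trans (cong f (sym (ℤ.+-assoc (a * + j) z (+ b)))) (per (a * + j + z))

  per-a : Periodic a H
  -- With the `j = 0` term restored, `H (z + a)` becomes a sum over `j ≤ b`, whose last term, at
  -- `j = b`, equals `f z` by periodicity.
  per-a z = +-cancelˡ (f z) (H (z + a)) (H z) (begin
    f z + H (z + a)                 ≡⟨ cong₂ _+_ (cong f (first a z)) (∑-ext b λ j → cong f (next a (+ j) z)) ⟩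
    f (a * + 0 + z) + ∑ b (λ j → f (a * + suc j + z)) ≡⟨ ∑-head b (λ j → f (a * + j + z)) ⟨
    H z + f (a * + b + z)           ≡⟨ cong (λ y → H z + f y) (ℤ.+-comm (a * + b) z) ⟩
    H z + f (z + a * + b)           ≡⟨ cong (_+_ (H z)) (periodic-* {+ b} a per z) ⟩
    H z + f z                       ≡⟨ ℤ.+-comm (H z) (f z) ⟩
    f z + H z                       ∎)
    where
    first : ∀ a z → z ≡ a * + 0 + z
    first = solve-∀
    next : ∀ a j z → a * j + (z + a) ≡ a * (1ℤ + j) + z
    next = solve-∀

  per-1 : Periodic 1ℤ H
  -- 1 = `d a - x b` is an integral combination of the two periods.
  per-1 = subst (λ p → Periodic p H) combination
    (periodic-+ {d * a} (periodic-* {a} d per-a) (periodic-* {+ b} (- x) per-b))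
    where
    cancel : ∀ x b → 1ℤ + x * b + - x * b ≡ 1ℤ
    cancel = solve-∀
    combination : d * a + - x * + b ≡ 1ℤ
    combination = trans (cong (_+ - x * + b) (trans (ℤ.*-comm d a) inv)) (cancel x (+ b))

∑-translate : ∀ b {f} → Periodic (+ b) f → ∀ z → ∑ b (λ j → f (z + + j)) ≡ ∑ b (λ j → f (+ j))
∑-translate b {f} per z = begin
  ∑ b (λ j → f (z + + j))        ≡⟨ ∑-ext b (λ j → cong f (lemma z (+ j))) ⟩
  ∑ b (λ j → f (1ℤ * + j + z))   ≡⟨ ∑-affine-const b per 1ℤ inverse-1 z 0ℤ ⟩
  ∑ b (λ j → f (1ℤ * + j + 0ℤ))  ≡⟨ ∑-ext b (λ j → cong f (lemma′ (+ j))) ⟩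
  ∑ b (λ j → f (+ j))            ∎
  where
  lemma : ∀ z j → z + j ≡ 1ℤ * j + z
  lemma = solve-∀
  lemma′ : ∀ j → 1ℤ * j + 0ℤ ≡ j
  lemma′ = solve-∀

-- Averaging over `z` avoids showing that `j ↦ a j + z` permutes the residues: the sum does not
-- depend on `z`, and adding it up over all `z` and exchanging the sums leaves `b` translated copies
-- of the right-hand side.
∑-affine : ∀ b .{{_ : NonZero b}} {f} → Periodic (+ b) f → ∀ a → Inverse a b →
  ∀ z → ∑ b (λ j → f (a * + j + z)) ≡ ∑ b (λ j → f (+ j))
∑-affine b {f} per a inv z = ℤ.*-cancelˡ-≡ (+ b) _ _ {{nz b}} (begin
  + b * H z                                       ≡⟨ ∑-const b (H z) ⟨
  ∑ b (λ _ → H z)                                 ≡⟨ ∑-ext b (λ y → ∑-affine-const b per a inv z (+ y)) ⟩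
  ∑ b (λ y → H (+ y))                             ≡⟨ ∑-swap b b (λ y j → f (a * + j + + y)) ⟩
  ∑ b (λ j → ∑ b (λ y → f (a * + j + + y)))       ≡⟨ ∑-ext b (λ j → ∑-translate b per (a * + j)) ⟩
  ∑ b (λ _ → ∑ b (λ y → f (+ y)))                 ≡⟨ ∑-const b _ ⟩
  + b * ∑ b (λ y → f (+ y))                       ∎)
  where
  H : ℤ → ℤ
  H z = ∑ b (λ j → f (a * + j + z))
  nz : ∀ b .{{_ : NonZero b}} → ℤ.NonZero (+ b)
  nz (suc _) = _

-- Division with remainder and centred residues.

divMod-unique : ∀ b .{{_ : NonZero b}} z r q → r < b → z ≡ + r + q * + b →
  z %ℕ b ≡ r × z /ℕ b ≡ q
divMod-unique b@(suc _) z r q r<b eq = r′≡r , q′≡q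
  where
  r′ = z %ℕ b
  q′ = z /ℕ b

  both : + r′ + q′ * + b ≡ + r + q * + b
  both = trans (sym (a≡a%ℕn+[a/ℕn]*n z b)) eq

  difference : + r′ - + r ≡ (q - q′) * + b
  difference = begin
    + r′ - + r                           ≡⟨ lem₁ (+ r′) (+ r) q′ (+ b) ⟩
    + r′ + q′ * + b - (+ r + q′ * + b)   ≡⟨ cong (_- (+ r + q′ * + b)) both ⟩
    + r + q * + b - (+ r + q′ * + b)     ≡⟨ lem₂ (+ r) q q′ (+ b) ⟩
    (q - q′) * + b                       ∎
    where
    lem₁ : ∀ r′ r q′ b → r′ - r ≡ r′ + q′ * b - (r + q′ * b)
    lem₁ = solve-∀
    lem₂ : ∀ r q q′ b → r + q * b - (r + q′ * b) ≡ (q - q′) * b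
    lem₂ = solve-∀

  small : ∣ + r′ - + r ∣ < b
  small = ℕ.≤-<-trans
    (subst (λ w → ∣ w ∣ ≤ r′ ℕ.⊔ r) (sym (ℤ.m-n≡m⊖n r′ r)) (ℤ.∣m⊝n∣≤m⊔n r′ r))
    (ℕ.⊔-lub (n%ℕd<d z b) r<b)

  vanishes : ∀ k → k < b → b ℕ.∣ k → k ≡ 0
  vanishes zero    _   _   = refl
  vanishes (suc k) k<b b∣k = contradiction b∣k (ℕ.>⇒∤ k<b)

  b∣ : b ℕ.∣ ∣ + r′ - + r ∣
  b∣ = ℕ.divides ∣ q - q′ ∣ (trans (cong ∣_∣ difference) (ℤ.abs-* (q - q′) (+ b)))

  r′≡r : r′ ≡ r
  r′≡r = ℤ.+-injective (ℤ.i-j≡0⇒i≡j _ _ (ℤ.∣i∣≡0⇒i≡0 (vanishes _ small b∣)))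

  q′≡q : q′ ≡ q
  q′≡q = ℤ.*-cancelʳ-≡ q′ q (+ b) (+-cancelˡ (+ r) _ _ (trans (cong (λ w → + w + q′ * + b) (sym r′≡r)) both))

%ℕ-unique : ∀ b .{{_ : NonZero b}} z r q → r < b → z ≡ + r + q * + b → z %ℕ b ≡ r
%ℕ-unique b z r q r<b eq = proj₁ (divMod-unique b z r q r<b eq)

-- The representative of z modulo b, centred so that the values over a residue system add up to 0.
c : (b : ℕ) .{{_ : NonZero b}} → ℤ → ℤ
c b z = + 2 * + (z %ℕ b) - + b + 1ℤ

c-≡ : ∀ b .{{_ : NonZero b}} z r q → r < b → z ≡ + r + q * + b → c b z ≡ + 2 * + r - + b + 1ℤ
c-≡ b z r q r<b eq = cong (λ w → + 2 * + w - + b + 1ℤ) (%ℕ-unique b z r q r<b eq)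

c-small : ∀ b .{{_ : NonZero b}} r → r < b → c b (+ r) ≡ + 2 * + r - + b + 1ℤ
c-small b r r<b = c-≡ b (+ r) r 0ℤ r<b (lemma (+ r) (+ b))
  where
  lemma : ∀ r b → r ≡ r + 0ℤ * b
  lemma = solve-∀

c-periodic : ∀ b .{{_ : NonZero b}} → Periodic (+ b) (c b)
c-periodic b z = c-≡ b (z + + b) (z %ℕ b) (z /ℕ b + 1ℤ) (n%ℕd<d z b)
  (trans (cong (_+ + b) (a≡a%ℕn+[a/ℕn]*n z b)) (lemma (+ (z %ℕ b)) (z /ℕ b) (+ b)))
  where
  lemma : ∀ r q b → r + q * b + b ≡ r + (q + 1ℤ) * b
  lemma = solve-∀

c-≡-mod : ∀ b .{{_ : NonZero b}} {y} z k → y ≡ z + k * + b → c b y ≡ c b z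
c-≡-mod b z k eq = trans (cong (c b) eq) (periodic-* {+ b} k (c-periodic b) z)

-- The partial sums have the closed form `m (m - b)`, which vanishes at `m = b`.
∑-c : ∀ b .{{_ : NonZero b}} → ∑ b (λ j → c b (+ j)) ≡ 0ℤ
∑-c b = trans (∑-cong b (c-small b)) (trans (closed b b) (lemma (+ b)))
  where
  closed : ∀ m b → ∑ m (λ j → + 2 * + j - + b + 1ℤ) ≡ + m * (+ m - + b)
  closed zero    b = sym (ℤ.*-zeroˡ (0ℤ - + b))
  closed (suc m) b = trans (cong (_+ (+ 2 * + m - + b + 1ℤ)) (closed m b)) (lem (+ m) (+ b))
    where
    lem : ∀ m b → m * (m - b) + (+ 2 * m - b + 1ℤ) ≡ (1ℤ + m) * (1ℤ + m - b)
    lem = solve-∀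
  lemma : ∀ b → b * (b - b) ≡ 0ℤ
  lemma = solve-∀

∑-c-affine : ∀ b .{{_ : NonZero b}} a → Inverse a b →
  ∀ z → ∑ b (λ j → c b (a * + j + z)) ≡ 0ℤ
∑-c-affine b a inv z = trans (∑-affine b (c-periodic b) a inv z) (∑-c b)

∑-c-unit : ∀ b .{{_ : NonZero b}} a → Inverse a b → ∑ b (λ j → c b (a * + j)) ≡ 0ℤ
∑-c-unit b a inv =
  trans (∑-ext b λ j → cong (c b) (sym (ℤ.+-identityʳ (a * + j)))) (∑-c-affine b a inv 0ℤ)

-- If `ρ` is the remainder of `y` modulo `b`, then `r + ρ L` is that of `z` modulo `b L`. The
-- centring constants fit together exactly, because `1 - b L = L (1 - b) + (1 - L)`.
c-split : ∀ b L .{{_ : NonZero b}} .{{_ : NonZero L}} .{{_ : NonZero (b ℕ.* L)}} z r y → r < L →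
  z ≡ + r + y * + L → c (b ℕ.* L) z ≡ + L * c b y + c L (+ r)
c-split b L z r y r<L eq = begin
  c (b ℕ.* L) z
    ≡⟨ c-≡ (b ℕ.* L) z (r ℕ.+ ρ ℕ.* L) q bound decomposition ⟩
  + 2 * + (r ℕ.+ ρ ℕ.* L) - + (b ℕ.* L) + 1ℤ
    ≡⟨ cong₂ (λ u v → + 2 * u - v + 1ℤ) (trans (ℤ.pos-+ r (ρ ℕ.* L)) (cong (_+_ (+ r)) (ℤ.pos-* ρ L))) (ℤ.pos-* b L) ⟩
  + 2 * (+ r + + ρ * + L) - + b * + L + 1ℤ
    ≡⟨ lem₂ (+ r) (+ ρ) (+ b) (+ L) ⟩
  + L * c b y + (+ 2 * + r - + L + 1ℤ)
    ≡⟨ cong (_+_ (+ L * c b y)) (c-small L r r<L) ⟨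
  + L * c b y + c L (+ r) ∎
  where
  ρ = y %ℕ b
  q = y /ℕ b

  bound : r ℕ.+ ρ ℕ.* L < b ℕ.* L
  bound = ℕ.<-≤-trans (ℕ.+-monoˡ-< (ρ ℕ.* L) r<L) (ℕ.*-monoˡ-≤ L (n%ℕd<d y b))

  lem₁ : ∀ r ρ q b L → r + (ρ + q * b) * L ≡ r + ρ * L + q * (b * L)
  lem₁ = solve-∀
  lem₂ : ∀ r ρ b L → + 2 * (r + ρ * L) - b * L + 1ℤ ≡ L * (+ 2 * ρ - b + 1ℤ) + (+ 2 * r - L + 1ℤ)
  lem₂ = solve-∀

  decomposition : z ≡ + (r ℕ.+ ρ ℕ.* L) + q * + (b ℕ.* L)
  decomposition = begin
    z                                        ≡⟨ eq ⟩
    + r + y * + L                            ≡⟨ cong (λ w → + r + w * + L) (a≡a%ℕn+[a/ℕn]*n y b) ⟩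
    + r + (+ ρ + q * + b) * + L              ≡⟨ lem₁ (+ r) (+ ρ) q (+ b) (+ L) ⟩
    + r + + ρ * + L + q * (+ b * + L)        ≡⟨ cong₂ (λ u v → + r + u + q * v) (ℤ.pos-* ρ L) (ℤ.pos-* b L) ⟨
    + (r ℕ.+ ρ ℕ.* L) + q * + (b ℕ.* L)      ∎

-- The correlation sums `E(a, b)` of centred residues.

correlation : (b : ℕ) .{{_ : NonZero b}} → ℤ → ℤ
correlation b a = ∑ b (λ k → c b (+ k) * c b (a * + k))

c-scale-periodic : ∀ b .{{_ : NonZero b}} a → Periodic (+ b) (λ z → c b (a * z))
c-scale-periodic b a z = c-≡-mod b (a * z) a (ℤ.*-distribˡ-+ a z (+ b))

∑-unit : ∀ b .{{_ : NonZero b}} {f} → Periodic (+ b) f → ∀ a → Inverse a b →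
  ∑ b (λ j → f (a * + j)) ≡ ∑ b (λ j → f (+ j))
∑-unit b {f} per a inv =
  trans (∑-ext b λ j → cong f (sym (ℤ.+-identityʳ (a * + j)))) (∑-affine b per a inv 0ℤ)

-- Nonzero opposite residues have remainders adding up to `b`, so the centring leaves
-- `2 b - 2 b + 2`.
c-neg : ∀ b .{{_ : NonZero b}} k → suc k < b → c b (+ suc k) + c b (-1ℤ * + suc k) ≡ + 2
c-neg b k k<b = begin
  c b (+ suc k) + c b (-1ℤ * + suc k)
    ≡⟨ cong₂ _+_ (c-small b (suc k) k<b) (c-≡ b _ u -1ℤ u<b (trans (lem₁ (+ suc k) (+ u)) (cong (λ w → + u + -1ℤ * w) total))) ⟩
  + 2 * + suc k - + b + 1ℤ + (+ 2 * + u - + b + 1ℤ)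
    ≡⟨ cong (λ w → + 2 * + suc k - w + 1ℤ + (+ 2 * + u - w + 1ℤ)) total ⟨
  + 2 * + suc k - (+ suc k + + u) + 1ℤ + (+ 2 * + u - (+ suc k + + u) + 1ℤ)
    ≡⟨ lem₂ (+ suc k) (+ u) ⟩
  + 2 ∎
  where
  u = b ℕ.∸ suc k
  sum : suc k ℕ.+ u ≡ b
  sum = ℕ.m+[n∸m]≡n (ℕ.<⇒≤ k<b)
  u<b : u < b
  u<b = subst (u <_) sum (ℕ.m<n+m u ℕ.z<s)
  total : + suc k + + u ≡ + b
  total = cong +_ sum
  lem₁ : ∀ k u → -1ℤ * k ≡ u + -1ℤ * (k + u)
  lem₁ = solve-∀
  lem₂ : ∀ k u → + 2 * k - (k + u) + 1ℤ + (+ 2 * u - (k + u) + 1ℤ) ≡ + 2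
  lem₂ = solve-∀

-- Substituting t ↦ a t and t ↦ - t turns the sum for a into the one for - a; the two cancel up to the defect of c at 0.
correlation-sqrt-1 : ∀ b .{{_ : NonZero b}} a x → a * a ≡ x * + b - 1ℤ →
  correlation b a ≡ + b * + b - + b
correlation-sqrt-1 b@(suc b-1) a x sqrt = ℤ.*-cancelˡ-≡ (+ 2) _ _ (begin
  + 2 * correlation b a
    ≡⟨ double (correlation b a) ⟩
  correlation b a + correlation b a
    ≡⟨ cong₂ _+_ via-a via-neg ⟩
  ∑ b (λ t → c b (+ t) * n t) + ∑ b (λ t → c b (-1ℤ * + t) * n t)
    ≡⟨ ∑-+ b (λ t → c b (+ t) * n t) (λ t → c b (-1ℤ * + t) * n t) ⟨
  ∑ b (λ t → c b (+ t) * n t + c b (-1ℤ * + t) * n t)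
    ≡⟨ ∑-ext b (λ t → ℤ.*-distribʳ-+ (n t) (c b (+ t)) (c b (-1ℤ * + t))) ⟨
  ∑ b (λ t → (c b (+ t) + c b (-1ℤ * + t)) * n t)
    ≡⟨ ∑-head b-1 (λ t → (c b (+ t) + c b (-1ℤ * + t)) * n t) ⟩
  (c b 0ℤ + c b 0ℤ) * n 0 + ∑ b-1 (λ t → (c b (+ suc t) + c b (-1ℤ * + suc t)) * n (suc t))
    -- Only `t = 0` escapes `c-neg`: there the pair adds up to `2 - 2 b`.
    ≡⟨ cong₂ _+_ (cong₂ (λ u v → (u + u) * v) c0 n0)
         (trans (∑-cong b-1 (λ t t< → cong (_* n (suc t)) (c-neg b t (s≤s t<)))) (∑-* b-1 (+ 2) (n ∘ suc))) ⟩
  (1ℤ - + b + (1ℤ - + b)) * (1ℤ - + b) + + 2 * ∑ b-1 (n ∘ suc)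
    ≡⟨ cong (λ w → (1ℤ - + b + (1ℤ - + b)) * (1ℤ - + b) + + 2 * w) tail ⟩
  (1ℤ - + b + (1ℤ - + b)) * (1ℤ - + b) + + 2 * (+ b - 1ℤ)
    ≡⟨ final (+ b) ⟩
  + 2 * (+ b * + b - + b) ∎)
  where
  n : ℕ → ℤ
  n t = c b (- a * + t)

  double : ∀ k → + 2 * k ≡ k + k
  double = solve-∀
  final : ∀ b → (1ℤ - b + (1ℤ - b)) * (1ℤ - b) + + 2 * (b - 1ℤ) ≡ + 2 * (b * b - b)
  final = solve-∀

  inverse : a * - a ≡ 1ℤ + - x * + b
  inverse = trans (lem₁ a) (trans (cong -_ sqrt) (lem₂ x (+ b)))
    where
    lem₁ : ∀ a → a * - a ≡ - (a * a)
    lem₁ = solve-∀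
    lem₂ : ∀ x b → - (x * b - 1ℤ) ≡ 1ℤ + - x * b
    lem₂ = solve-∀

  inverse′ : - a * a ≡ 1ℤ + - x * + b
  inverse′ = trans (ℤ.*-comm (- a) a) inverse

  -- Substituting `a t` into `c z * c (- a z)` swaps the two factors, since `- a` is inverse to `a`.
  via-a : correlation b a ≡ ∑ b (λ t → c b (+ t) * n t)
  via-a = trans (∑-ext b term) (∑-unit b {λ z → c b z * c b (- a * z)} per a (- a , - x , inverse))
    where
    per : Periodic (+ b) (λ z → c b z * c b (- a * z))
    per z = cong₂ _*_ (c-periodic b z) (c-scale-periodic b (- a) z)
    reassoc : ∀ a t → - a * (a * t) ≡ - a * a * t
    reassoc = solve-∀
    expand : ∀ t x b → (1ℤ + - x * b) * t ≡ t + - x * t * b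
    expand = solve-∀
    term : ∀ t → c b (+ t) * c b (a * + t) ≡ c b (a * + t) * c b (- a * (a * + t))
    term t = trans (ℤ.*-comm (c b (+ t)) (c b (a * + t))) (cong (c b (a * + t) *_) (sym (c-≡-mod b (+ t) (- x * + t)
      (trans (reassoc a (+ t)) (trans (cong (_* + t) inverse′) (expand (+ t) x (+ b)))))))

  via-neg : correlation b a ≡ ∑ b (λ t → c b (-1ℤ * + t) * n t)
  via-neg = trans (sym (∑-unit b {λ z → c b z * c b (a * z)} per -1ℤ inverse-neg-1)) (∑-ext b term)
    where
    per : Periodic (+ b) (λ z → c b z * c b (a * z))
    per z = cong₂ _*_ (c-periodic b z) (c-scale-periodic b a z)
    lem : ∀ a t → a * (-1ℤ * t) ≡ - a * t
    lem = solve-∀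
    term : ∀ t → c b (-1ℤ * + t) * c b (a * (-1ℤ * + t)) ≡ c b (-1ℤ * + t) * n t
    term t = cong (λ z → c b (-1ℤ * + t) * c b z) (lem a (+ t))

  c0 : c b 0ℤ ≡ 1ℤ - + b
  c0 = trans (c-small b 0 ℕ.z<s) (lem (+ b))
    where
    lem : ∀ b → + 2 * 0ℤ - b + 1ℤ ≡ 1ℤ - b
    lem = solve-∀

  n0 : n 0 ≡ 1ℤ - + b
  n0 = trans (cong (c b) (ℤ.*-zeroʳ (- a))) c0

  -- The sum of `n` over all residues vanishes because `- a` is a unit, so the rest must cancel the
  -- term at 0.
  tail : ∑ b-1 (n ∘ suc) ≡ + b - 1ℤ
  tail = +-cancelˡ (n 0) _ _ (begin
    n 0 + ∑ b-1 (n ∘ suc)   ≡⟨ ∑-head b-1 n ⟨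
    ∑ b n                   ≡⟨ ∑-c-unit b (- a) (a , - x , inverse′) ⟩
    0ℤ                      ≡⟨ lem (+ b) ⟩
    1ℤ - + b + (+ b - 1ℤ)   ≡⟨ cong (_+ (+ b - 1ℤ)) n0 ⟨
    n 0 + (+ b - 1ℤ)        ∎)
    where
    lem : ∀ b → 0ℤ ≡ 1ℤ - b + (b - 1ℤ)
    lem = solve-∀

-- Passing from the modulus `b` to `b L`.

module Inflate (b : ℕ) .{{_ : NonZero b}} (i : ℕ) where

  -- This choice makes `n` ≡ 0 and `L` ≡ 1 modulo `b`, while n² ≡ -1 modulo `L`.
  n L : ℕ
  n = i ℕ.* b
  L = suc (n ℕ.* n)

  instance
    bL-nonZero : NonZero (b ℕ.* L)
    bL-nonZero = ℕ.m*n≢0 b L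

  +n : + n ≡ + i * + b
  +n = ℤ.pos-* i b

  +L : + L ≡ 1ℤ + + n * + n
  +L = cong (_+_ 1ℤ) (ℤ.pos-* n n)

  +⟨_*_+_⟩ : ∀ p m q → + (p ℕ.* m ℕ.+ q) ≡ + p * + m + + q
  +⟨ p * m + q ⟩ = cong (_+ + q) (ℤ.pos-* p m)

  n<L : n < L
  n<L = s≤s (n≤n² n)
    where
    n≤n² : ∀ n → n ≤ n ℕ.* n
    n≤n² zero    = z≤n
    n≤n² (suc n) = ℕ.m≤m*n (suc n) (suc n)

  -- The carry into the multiple of `L` when `a′ a * (j L + t)` is divided by `L`.
  φ : ℕ → ℤ
  φ t = (- + n * + t) /ℕ L

  φ₀ : ℕ → ℤ
  φ₀ zero    = 0ℤ
  φ₀ (suc _) = -1ℤ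

  φ-≡ : ∀ t r q → r < L → - + n * + t ≡ + r + q * + L → φ t ≡ q
  φ-≡ t r q r<L eq = proj₂ (divMod-unique L (- + n * + t) r q r<L eq)

  -- One has `- n (p n + q) = - p L + (p - n q)`. For `q = 0` the bracket is already a remainder;
  -- for `0 < q < n` it lies between `- L` and 0, which costs one further unit, recorded by `φ₀`.
  φ-block : ∀ p q → p < n → q < n → φ (p ℕ.* n ℕ.+ q) ≡ -1ℤ * + p + φ₀ q
  φ-block p zero p<n _ = φ-≡ _ p _ (ℕ.<-trans p<n n<L) (begin
    - + n * + (p ℕ.* n ℕ.+ 0)                  ≡⟨ cong (- + n *_) +⟨ p * n + 0 ⟩ ⟩
    - + n * (+ p * + n + 0ℤ)                   ≡⟨ lem (+ n) (+ p) ⟩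
    + p + (-1ℤ * + p + 0ℤ) * (1ℤ + + n * + n)  ≡⟨ cong (λ w → + p + (-1ℤ * + p + 0ℤ) * w) +L ⟨
    + p + (-1ℤ * + p + 0ℤ) * + L               ∎)
    where
    lem : ∀ n p → - n * (p * n + 0ℤ) ≡ p + (-1ℤ * p + 0ℤ) * (1ℤ + n * n)
    lem = solve-∀
  φ-block p (suc q) p<n q<n = φ-≡ _ r _ (s≤s bound) (begin
    - + n * + (p ℕ.* n ℕ.+ suc q)                        ≡⟨ cong (- + n *_) +⟨ p * n + suc q ⟩ ⟩
    - + n * (+ p * + n + + suc q)                        ≡⟨ lem₁ (+ n) (+ p) (+ suc q) ⟩
    + n * + n - + n * + suc q + + p + 1ℤ + (-1ℤ * + p + -1ℤ) * (1ℤ + + n * + n)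
      ≡⟨ cong (λ w → + n * w - + n * + suc q + + p + 1ℤ + (-1ℤ * + p + -1ℤ) * (1ℤ + + n * + n)) total ⟨
    + n * (+ suc q + + u) - + n * + suc q + + p + 1ℤ + (-1ℤ * + p + -1ℤ) * (1ℤ + + n * + n)
      ≡⟨ cong (_+ (-1ℤ * + p + -1ℤ) * (1ℤ + + n * + n)) (lem₂ (+ n) (+ suc q) (+ u) (+ p)) ⟩
    + u * + n + (1ℤ + + p) + (-1ℤ * + p + -1ℤ) * (1ℤ + + n * + n)
      ≡⟨ cong₂ (λ v w → v + (-1ℤ * + p + -1ℤ) * w) +⟨ u * n + suc p ⟩ +L ⟨
    + r + (-1ℤ * + p + -1ℤ) * + L ∎)
    where
    u = n ℕ.∸ suc q
    r = u ℕ.* n ℕ.+ suc p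
    sum : suc q ℕ.+ u ≡ n
    sum = ℕ.m+[n∸m]≡n (ℕ.<⇒≤ q<n)
    total : + suc q + + u ≡ + n
    total = cong +_ sum
    u<n : u < n
    u<n = subst (u <_) sum (ℕ.m<n+m u ℕ.z<s)
    -- `u ≤ n - 1` and `p + 1 ≤ n`, so the remainder is at most n² = `L - 1`.
    bound : r ≤ n ℕ.* n
    bound = ℕ.≤-trans (ℕ.+-monoʳ-≤ (u ℕ.* n) p<n)
      (subst (_≤ n ℕ.* n) (ℕ.+-comm n (u ℕ.* n)) (ℕ.*-monoˡ-≤ n u<n))
    lem₁ : ∀ n p q → - n * (p * n + q) ≡ n * n - n * q + p + 1ℤ + (-1ℤ * p + -1ℤ) * (1ℤ + n * n)
    lem₁ = solve-∀
    lem₂ : ∀ n q u p → n * (q + u) - n * q + p + 1ℤ ≡ u * n + (1ℤ + p)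
    lem₂ = solve-∀

  -- As n² = `L - 1`, the dividend is `n - n L`, with remainder `n < L`.
  φ-last : φ (n ℕ.* n) ≡ - + n
  φ-last = φ-≡ _ n (- + n) n<L (begin
    - + n * + (n ℕ.* n)               ≡⟨ cong (- + n *_) (ℤ.pos-* n n) ⟩
    - + n * (+ n * + n)               ≡⟨ lem (+ n) ⟩
    + n + - + n * (1ℤ + + n * + n)    ≡⟨ cong (λ w → + n + - + n * w) +L ⟨
    + n + - + n * + L                 ∎)
    where
    lem : ∀ n → - n * (n * n) ≡ n + - n * (1ℤ + n * n)
    lem = solve-∀

  -- Since `n = i b`, the range of `p` consists of `i` complete residue systems modulo `b`.
  ∑-c-neg : ∀ w → ∑ n (λ p → c b (-1ℤ * + p + w)) ≡ 0ℤ
  ∑-c-neg w = begin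
    ∑ n (λ p → c b (-1ℤ * + p + w))
      ≡⟨ ∑-blocks i b (λ p → c b (-1ℤ * + p + w)) ⟩
    ∑ i (λ u → ∑ b (λ v → c b (-1ℤ * + (u ℕ.* b ℕ.+ v) + w)))
      ≡⟨ ∑-ext i (λ u → ∑-ext b (λ v → cong (c b) (trans (cong (λ z → -1ℤ * z + w) +⟨ u * b + v ⟩) (lem (+ u) (+ b) (+ v) w)))) ⟩
    ∑ i (λ u → ∑ b (λ v → c b (-1ℤ * + v + (w - + u * + b))))
      ≡⟨ ∑-ext i (λ u → ∑-c-affine b -1ℤ inverse-neg-1 (w - + u * + b)) ⟩
    ∑ i (λ _ → 0ℤ)
      ≡⟨ ∑-0 i ⟩
    0ℤ ∎
    where
    lem : ∀ u b v w → -1ℤ * (u * b + v) + w ≡ -1ℤ * v + (w - u * b)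
    lem = solve-∀

  -- For t = p n + q with p < n the floor φ t decreases by 1 with each step of p, so these terms run through
  -- complete residue systems and cancel; only t = n² survives.
  ∑-c-floor : ∀ a z → ∑ L (λ t → c b (z + (a * + t + φ t))) ≡ c b z
  ∑-c-floor a z = begin
    ∑ (n ℕ.* n) g + g (n ℕ.* n)
      ≡⟨ cong (_+ g (n ℕ.* n)) (∑-blocks n n g) ⟩
    ∑ n (λ p → ∑ n (λ q → g (p ℕ.* n ℕ.+ q))) + g (n ℕ.* n)
      ≡⟨ cong (_+ g (n ℕ.* n)) (∑-swap n n (λ p q → g (p ℕ.* n ℕ.+ q))) ⟩
    ∑ n (λ q → ∑ n (λ p → g (p ℕ.* n ℕ.+ q))) + g (n ℕ.* n)
      ≡⟨ cong₂ _+_ (trans (∑-cong n λ q q<n → trans (∑-cong n λ p p<n → block p q p<n q<n) (∑-c-neg (z + a * + q + φ₀ q)))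
                          (∑-0 n)) last ⟩
    0ℤ + c b z
      ≡⟨ ℤ.+-identityˡ (c b z) ⟩
    c b z ∎
    where
    g : ℕ → ℤ
    g t = c b (z + (a * + t + φ t))

    -- The offset `a n² - n` at `t = n²` is a multiple of `n`, hence of `b`.
    last : g (n ℕ.* n) ≡ c b z
    last = c-≡-mod b z ((a * + n - 1ℤ) * + i) (begin
      z + (a * + (n ℕ.* n) + φ (n ℕ.* n))     ≡⟨ cong₂ (λ u v → z + (a * u + v)) (ℤ.pos-* n n) φ-last ⟩
      z + (a * (+ n * + n) + - + n)           ≡⟨ lem₁ z a (+ n) ⟩
      z + (a * + n - 1ℤ) * + n                ≡⟨ cong (λ w → z + (a * + n - 1ℤ) * w) +n ⟩
      z + (a * + n - 1ℤ) * (+ i * + b)        ≡⟨ cong (_+_ z) (ℤ.*-assoc (a * + n - 1ℤ) (+ i) (+ b)) ⟨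
      z + (a * + n - 1ℤ) * + i * + b          ∎)
      where
      lem₁ : ∀ z a n → z + (a * (n * n) + - n) ≡ z + (a * n - 1ℤ) * n
      lem₁ = solve-∀

    -- The part `a p n` drops out modulo `b`, so `p` enters only through the floor.
    block : ∀ p q → p < n → q < n → g (p ℕ.* n ℕ.+ q) ≡ c b (-1ℤ * + p + (z + a * + q + φ₀ q))
    block p q p<n q<n = c-≡-mod b (-1ℤ * + p + (z + a * + q + φ₀ q)) (a * + p * + i) (begin
      z + (a * + (p ℕ.* n ℕ.+ q) + φ (p ℕ.* n ℕ.+ q))
        ≡⟨ cong₂ (λ u v → z + (a * u + v)) +⟨ p * n + q ⟩ (φ-block p q p<n q<n) ⟩
      z + (a * (+ p * + n + + q) + (-1ℤ * + p + φ₀ q))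
        ≡⟨ cong (λ w → z + (a * (+ p * w + + q) + (-1ℤ * + p + φ₀ q))) +n ⟩
      z + (a * (+ p * (+ i * + b) + + q) + (-1ℤ * + p + φ₀ q))
        ≡⟨ lem z a (+ p) (+ i) (+ b) (+ q) (φ₀ q) ⟩
      -1ℤ * + p + (z + a * + q + φ₀ q) + a * + p * + i * + b ∎)
      where
      lem : ∀ z a p i b q f → z + (a * (p * (i * b) + q) + (-1ℤ * p + f)) ≡
            -1ℤ * p + (z + a * q + f) + a * p * i * b
      lem = solve-∀

  -- Congruent to `a` modulo `b` and to `- n` modulo `L`.
  a′ : ℤ → ℤ
  a′ a = a * + L - + n

  -- By `c-split` the factors at `k = j L + t` are `L C + D` and `L X + D′`. Summed up, `C X` yields
  -- the correlation of `a` by `∑-c-floor`, `C D′` vanishes over `t`, `D X` vanishes over `j`, and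
  -- `D D′` yields `K` for each `j`.
  correlation-inflate : ∀ a → Inverse a b →
    correlation (b ℕ.* L) (a′ a) ≡ + L * + L * correlation b a + + b * (+ L * + L - + L)
  correlation-inflate a inv = begin
    ∑ (b ℕ.* L) (λ k → c (b ℕ.* L) (+ k) * c (b ℕ.* L) (a′ a * + k))
      ≡⟨ ∑-blocks b L (λ k → c (b ℕ.* L) (+ k) * c (b ℕ.* L) (a′ a * + k)) ⟩
    ∑ b (λ j → ∑ L (λ t → c (b ℕ.* L) (+ (j ℕ.* L ℕ.+ t)) * c (b ℕ.* L) (a′ a * + (j ℕ.* L ℕ.+ t))))
      ≡⟨ ∑-ext b (λ j → ∑-cong L (λ t t<L → cong₂ _*_ (left j t t<L) (right j t))) ⟩
    ∑ b (λ j → ∑ L (λ t → (+ L * C j + D t) * (+ L * X j t + D′ t)))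
      ≡⟨ ∑-ext b inner ⟩
    ∑ b (λ j → + L * + L * (C j * c b (a * + j)) + (+ L * ∑ L (λ t → D t * X j t) + K))
      ≡⟨ ∑-+ b _ _ ⟩
    ∑ b (λ j → + L * + L * (C j * c b (a * + j))) + ∑ b (λ j → + L * ∑ L (λ t → D t * X j t) + K)
      ≡⟨ cong₂ _+_ (∑-* b (+ L * + L) _) (trans (∑-+ b _ _) (cong₂ _+_ (∑-* b (+ L) _) (∑-const b K))) ⟩
    + L * + L * correlation b a + (+ L * ∑ b (λ j → ∑ L (λ t → D t * X j t)) + + b * K)
      ≡⟨ cong₂ (λ u v → + L * + L * correlation b a + (+ L * u + + b * v)) cross
           (correlation-sqrt-1 L (- + n) 1ℤ (trans (lem₁ (+ n)) (cong (λ w → 1ℤ * w - 1ℤ) (sym +L)))) ⟩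
    + L * + L * correlation b a + (+ L * 0ℤ + + b * (+ L * + L - + L))
      ≡⟨ lem₂ (+ L) (correlation b a) (+ b) ⟩
    + L * + L * correlation b a + + b * (+ L * + L - + L) ∎
    where
    C D D′ : ℕ → ℤ
    C j = c b (+ j)
    D t = c L (+ t)
    D′ t = c L (- + n * + t)

    X : ℕ → ℕ → ℤ
    X j t = c b (a * + j + (a * + t + φ t))

    K : ℤ
    K = correlation L (- + n)

    lem₁ : ∀ n → - n * - n ≡ 1ℤ * (1ℤ + n * n) - 1ℤ
    lem₁ = solve-∀
    lem₂ : ∀ L e b → L * L * e + (L * 0ℤ + b * (L * L - L)) ≡ L * L * e + b * (L * L - L)
    lem₂ = solve-∀

    left : ∀ j t → t < L → c (b ℕ.* L) (+ (j ℕ.* L ℕ.+ t)) ≡ + L * C j + D t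
    left j t t<L = c-split b L _ t (+ j) t<L (trans +⟨ j * L + t ⟩ (ℤ.+-comm (+ j * + L) (+ t)))

    right : ∀ j t → c (b ℕ.* L) (a′ a * + (j ℕ.* L ℕ.+ t)) ≡ + L * X j t + D′ t
    right j t = begin
      c (b ℕ.* L) (a′ a * + (j ℕ.* L ℕ.+ t))
        ≡⟨ c-split b L _ ρ (a′ a * + j + (a * + t + φ t)) (n%ℕd<d (- + n * + t) L) quotient ⟩
      + L * c b (a′ a * + j + (a * + t + φ t)) + c L (+ ρ)
        ≡⟨ cong₂ (λ u v → + L * u + v) (c-≡-mod b (a * + j + (a * + t + φ t)) ((a * + n - 1ℤ) * + i * + j) reduce)
             (sym (c-≡-mod L (+ ρ) (φ t) (a≡a%ℕn+[a/ℕn]*n (- + n * + t) L))) ⟩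
      + L * X j t + D′ t ∎
      where
      ρ = (- + n * + t) %ℕ L

      quotient : a′ a * + (j ℕ.* L ℕ.+ t) ≡ + ρ + (a′ a * + j + (a * + t + φ t)) * + L
      quotient = begin
        a′ a * + (j ℕ.* L ℕ.+ t)
          ≡⟨ cong (a′ a *_) +⟨ j * L + t ⟩ ⟩
        a′ a * (+ j * + L + + t)
          ≡⟨ lem a (+ j) (+ L) (+ t) (+ n) ⟩
        - + n * + t + (a′ a * + j + a * + t) * + L
          ≡⟨ cong (_+ (a′ a * + j + a * + t) * + L) (a≡a%ℕn+[a/ℕn]*n (- + n * + t) L) ⟩
        + ρ + φ t * + L + (a′ a * + j + a * + t) * + L
          ≡⟨ lem′ (+ ρ) (φ t) (+ L) (a′ a * + j) (a * + t) ⟩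
        + ρ + (a′ a * + j + (a * + t + φ t)) * + L ∎
        where
        lem : ∀ a j L t n → (a * L - n) * (j * L + t) ≡ - n * t + ((a * L - n) * j + a * t) * L
        lem = solve-∀
        lem′ : ∀ r f L u v → r + f * L + (u + v) * L ≡ r + (u + (v + f)) * L
        lem′ = solve-∀

      reduce : a′ a * + j + (a * + t + φ t) ≡ a * + j + (a * + t + φ t) + (a * + n - 1ℤ) * + i * + j * + b
      reduce = begin
        (a * + L - + n) * + j + (a * + t + φ t)
          ≡⟨ cong (λ w → (a * w - + n) * + j + (a * + t + φ t)) +L ⟩
        (a * (1ℤ + + n * + n) - + n) * + j + (a * + t + φ t)
          ≡⟨ lem a (+ n) (+ j) (a * + t + φ t) ⟩
        a * + j + (a * + t + φ t) + (a * + n - 1ℤ) * + n * + j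
          ≡⟨ cong (λ w → a * + j + (a * + t + φ t) + (a * + n - 1ℤ) * w * + j) +n ⟩
        a * + j + (a * + t + φ t) + (a * + n - 1ℤ) * (+ i * + b) * + j
          ≡⟨ cong (_+_ (a * + j + (a * + t + φ t))) (lem′ (a * + n - 1ℤ) (+ i) (+ b) (+ j)) ⟩
        a * + j + (a * + t + φ t) + (a * + n - 1ℤ) * + i * + j * + b ∎
        where
        lem : ∀ a n j r → (a * (1ℤ + n * n) - n) * j + r ≡ a * j + r + (a * n - 1ℤ) * n * j
        lem = solve-∀
        lem′ : ∀ u i b j → u * (i * b) * j ≡ u * i * j * b
        lem′ = solve-∀

    inner : ∀ j → ∑ L (λ t → (+ L * C j + D t) * (+ L * X j t + D′ t)) ≡
      + L * + L * (C j * c b (a * + j)) + (+ L * ∑ L (λ t → D t * X j t) + K)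
    inner j = begin
      ∑ L (λ t → (+ L * C j + D t) * (+ L * X j t + D′ t))
        ≡⟨ ∑-ext L (λ t → expand (+ L) (C j) (D t) (X j t) (D′ t)) ⟩
      ∑ L (λ t → (+ L * + L * C j * X j t + + L * C j * D′ t) + (+ L * (D t * X j t) + D t * D′ t))
        ≡⟨ trans (∑-+ L _ _) (cong₂ _+_
             (trans (∑-+ L _ _) (cong₂ _+_ (∑-* L (+ L * + L * C j) (X j)) (∑-* L (+ L * C j) D′)))
             (trans (∑-+ L _ _) (cong (_+ K) (∑-* L (+ L) (λ t → D t * X j t))))) ⟩
      (+ L * + L * C j * ∑ L (X j) + + L * C j * ∑ L D′) + (+ L * ∑ L (λ t → D t * X j t) + K)
        ≡⟨ cong (_+ (+ L * ∑ L (λ t → D t * X j t) + K)) (trans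
             (cong₂ (λ u v → + L * + L * C j * u + + L * C j * v) (∑-c-floor a (a * + j))
               -- `n` inverts `- n` modulo `L`, because `- n n = 1 - L`.
               (∑-c-unit L (- + n) (+ n , -1ℤ , trans (lem (+ n)) (cong (λ w → 1ℤ + -1ℤ * w) (sym +L)))))
             (lem′ (+ L) (C j) (c b (a * + j)))) ⟩
      + L * + L * (C j * c b (a * + j)) + (+ L * ∑ L (λ t → D t * X j t) + K) ∎
      where
      expand : ∀ L c d x e → (L * c + d) * (L * x + e) ≡ (L * L * c * x + L * c * e) + (L * (d * x) + d * e)
      expand = solve-∀
      lem : ∀ n → - n * n ≡ 1ℤ + -1ℤ * (1ℤ + n * n)
      lem = solve-∀
      lem′ : ∀ L c x → L * L * c * x + L * c * 0ℤ ≡ L * L * (c * x)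
      lem′ = solve-∀

    cross : ∑ b (λ j → ∑ L (λ t → D t * X j t)) ≡ 0ℤ
    cross = begin
      ∑ b (λ j → ∑ L (λ t → D t * X j t))   ≡⟨ ∑-swap b L (λ j t → D t * X j t) ⟩
      ∑ L (λ t → ∑ b (λ j → D t * X j t))   ≡⟨ ∑-ext L (λ t → ∑-* b (D t) (λ j → X j t)) ⟩
      ∑ L (λ t → D t * ∑ b (λ j → X j t))   ≡⟨ ∑-ext L (λ t → trans (cong (D t *_) (∑-c-affine b a inv (a * + t + φ t))) (ℤ.*-zeroʳ (D t))) ⟩
      ∑ L (λ _ → 0ℤ)                        ≡⟨ ∑-0 L ⟩
      0ℤ                                    ∎

-- Integers and fractions inside the rationals.

ι : ℤ → ℚ
ι z = z / 1

-- Lets equalities of normalised rationals be checked as cross-multiplied integer identities.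
toℚᵘ-/ : ∀ z b .{{_ : NonZero b}} → toℚᵘ (z / b) ≃ᵘ mkℚᵘ z (ℕ.pred b)
toℚᵘ-/ z (suc b-1) = Q.toℚᵘ-fromℚᵘ (mkℚᵘ z b-1)

ι-+ : ∀ y z → ι (y + z) ≡ ι y Q.+ ι z
ι-+ y z = Q.toℚᵘ-injective (ℚᵘ.≃-trans (toℚᵘ-/ (y + z) 1) (ℚᵘ.≃-trans (*≡* (lem y z))
  (ℚᵘ.≃-sym (ℚᵘ.≃-trans (Q.toℚᵘ-homo-+ (ι y) (ι z)) (ℚᵘ.+-cong (toℚᵘ-/ y 1) (toℚᵘ-/ z 1))))))
  where
  lem : ∀ y z → (y + z) * 1ℤ ≡ (y * 1ℤ + z * 1ℤ) * 1ℤ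
  lem = solve-∀

ι-* : ∀ y z → ι (y * z) ≡ ι y Q.* ι z
ι-* y z = Q.toℚᵘ-injective (ℚᵘ.≃-trans (toℚᵘ-/ (y * z) 1)
  (ℚᵘ.≃-sym (ℚᵘ.≃-trans (Q.toℚᵘ-homo-* (ι y) (ι z)) (ℚᵘ.*-cong (toℚᵘ-/ y 1) (toℚᵘ-/ z 1)))))

ι-neg : ∀ z → ι (- z) ≡ Q.- ι z
ι-neg z = Q.toℚᵘ-injective (ℚᵘ.≃-trans (toℚᵘ-/ (- z) 1)
  (ℚᵘ.≃-sym (ℚᵘ.≃-trans (Q.toℚᵘ-homo‿- (ι z)) (ℚᵘ.-‿cong (toℚᵘ-/ z 1)))))

ι-minus : ∀ y z → ι (y - z) ≡ ι y Q.- ι z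
ι-minus y z = trans (ι-+ y (- z)) (cong (ι y Q.+_) (ι-neg z))

/-*-ι : ∀ z b .{{_ : NonZero b}} → z / b Q.* ι (+ b) ≡ ι z
/-*-ι z b@(suc b-1) = Q.toℚᵘ-injective (ℚᵘ.≃-trans (Q.toℚᵘ-homo-* (z / b) (ι (+ b)))
  (ℚᵘ.≃-trans (ℚᵘ.*-cong (toℚᵘ-/ z b) (toℚᵘ-/ (+ b) 1))
  (ℚᵘ.≃-trans (*≡* (trans (lem z (+ b)) (cong (λ w → z * + suc w) (sym (ℕ.*-identityʳ b-1))))) (ℚᵘ.≃-sym (toℚᵘ-/ z 1)))))
  where
  lem : ∀ z b → z * b * 1ℤ ≡ z * b
  lem = solve-∀

n/n≡1 : ∀ b .{{_ : NonZero b}} → + b / b ≡ 1ℚ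
n/n≡1 b@(suc b-1) = Q.toℚᵘ-injective (ℚᵘ.≃-trans (toℚᵘ-/ (+ b) b) (*≡* (ℤ.*-comm (+ b) 1ℤ)))

ι-cancel : ∀ m .{{_ : NonZero m}} {p q} → p Q.* ι (+ m) ≡ q Q.* ι (+ m) → p ≡ q
ι-cancel m eq = Q.≤-antisym (cancel eq) (cancel (sym eq))
  where
  instance
    pos : Q.Positive (ι (+ m))
    pos = Q.normalize-pos m 1
  cancel : ∀ {p q} → p Q.* ι (+ m) ≡ q Q.* ι (+ m) → p Q.≤ q
  cancel eq = Q.*-cancelʳ-≤-pos (ι (+ m)) (Q.≤-reflexive eq)

-- `floor` divides the reduced numerator by the reduced denominator; restoring the common factor `g`
-- multiplies the remainder by `g` and keeps the quotient.
floor-/ : ∀ z b .{{_ : NonZero b}} → floor (z / b) ≡ z /ℕ b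
floor-/ z b = reduced (z / b) _ (Q.↥-/ z b) (Q.↧-/ z b)
  where
  reduced : ∀ p g → ↥ p * + g ≡ z → ↧ p * + g ≡ + b → floor p ≡ z /ℕ b
  reduced (mkℚ N D-1 _) g Ng≡z Dg≡b =
    trans (div-pos-is-/ℕ N D) (sym (proj₂ (divMod-unique b z (r ℕ.* g) k bound decomposition)))
    where
    D = suc D-1
    r = N %ℕ D
    k = N /ℕ D
    D*g≡b : D ℕ.* g ≡ b
    D*g≡b = ℤ.+-injective (trans (ℤ.pos-* D g) Dg≡b)
    instance
      g≢0 : NonZero g
      g≢0 = ℕ.m*n≢0⇒n≢0 D {{subst NonZero (sym D*g≡b) (ℕ.>-nonZero (ℕ.>-nonZero⁻¹ b))}}
    bound : r ℕ.* g < b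
    bound = subst (r ℕ.* g <_) D*g≡b (ℕ.*-monoˡ-< g (n%ℕd<d N D))
    lem : ∀ r k D g → (r + k * D) * g ≡ r * g + k * (D * g)
    lem = solve-∀
    decomposition : z ≡ + (r ℕ.* g) + k * + b
    decomposition = begin
      z                             ≡⟨ Ng≡z ⟨
      N * + g                       ≡⟨ cong (_* + g) (a≡a%ℕn+[a/ℕn]*n N D) ⟩
      (+ r + k * + D) * + g         ≡⟨ lem (+ r) k (+ D) (+ g) ⟩
      + r * + g + k * (+ D * + g)   ≡⟨ cong₂ (λ u v → u + k * v) (sym (ℤ.pos-* r g)) Dg≡b ⟩
      + (r ℕ.* g) + k * + b         ∎

-- A reduced denominator 1 forces the gcd to be `b` itself.
↧≡1⇒%≡0 : ∀ z b .{{_ : NonZero b}} → ↧ₙ (z / b) ≡ 1 → z %ℕ b ≡ 0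
↧≡1⇒%≡0 z b eq = %ℕ-unique b z 0 (↥ (z / b)) (ℕ.>-nonZero⁻¹ b) (begin
  z                           ≡⟨ Q.↥-/ z b ⟨
  ↥ (z / b) * g               ≡⟨ cong (↥ (z / b) *_) g≡b ⟩
  ↥ (z / b) * + b             ≡⟨ ℤ.+-identityˡ _ ⟨
  0ℤ + ↥ (z / b) * + b        ∎)
  where
  g = gcd z (+ b)
  g≡b : g ≡ + b
  g≡b = begin
    g                ≡⟨ ℤ.*-identityˡ g ⟨
    1ℤ * g           ≡⟨ cong (λ w → + w * g) eq ⟨
    ↧ (z / b) * g    ≡⟨ Q.↧-/ z b ⟩
    + b              ∎

-- From the Dedekind sum to the correlation sum.

saw-nonInteger : ∀ p → ↧ₙ p ≢ 1 → saw p ≡ p Q.- (floor p / 1) Q.- ½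
saw-nonInteger p ≢1 with ↧ₙ p ℕ.≟ 1
... | yes ≡1 = contradiction ≡1 ≢1
... | no  _  = refl

-- Clearing denominators in `z / b - q - ½` gives `2 (z - q b) - b`, where `z - q b` is the
-- remainder. Multiples of `b` are excluded: there the sawtooth is 0 but `c b z - 1` is `- b`.
saw-c : ∀ b .{{_ : NonZero b}} z → z %ℕ b ≢ 0 → saw (z / b) Q.* ι (+ (2 ℕ.* b)) ≡ ι (c b z - 1ℤ)
saw-c b z ≢0 = begin
  saw (z / b) Q.* ι (+ (2 ℕ.* b))
    ≡⟨ cong₂ Q._*_ (trans (saw-nonInteger (z / b) (≢0 ∘ ↧≡1⇒%≡0 z b)) (cong (λ w → z / b Q.- ι w Q.- ½) (floor-/ z b)))
         (trans (cong ι (ℤ.pos-* 2 b)) (ι-* (+ 2) (+ b))) ⟩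
  (z / b Q.- ι q Q.- ½) Q.* (ι (+ 2) Q.* ι (+ b))
    ≡⟨ expand (z / b) (ι q) ½ (ι (+ 2)) (ι (+ b)) ⟩
  ι (+ 2) Q.* (z / b Q.* ι (+ b)) Q.- ι (+ 2) Q.* (ι q Q.* ι (+ b)) Q.- (½ Q.* ι (+ 2)) Q.* ι (+ b)
    -- `½ * ι 2` evaluates to 1.
    ≡⟨ cong₂ Q._-_ (cong₂ (λ u v → ι (+ 2) Q.* u Q.- ι (+ 2) Q.* v) (/-*-ι z b) (sym (ι-* q (+ b))))
         (Q.*-identityˡ (ι (+ b))) ⟩
  ι (+ 2) Q.* ι z Q.- ι (+ 2) Q.* ι (q * + b) Q.- ι (+ b)
    ≡⟨ cong (Q._- ι (+ b)) (cong₂ Q._-_ (ι-* (+ 2) z) (ι-* (+ 2) (q * + b))) ⟨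
  ι (+ 2 * z) Q.- ι (+ 2 * (q * + b)) Q.- ι (+ b)
    ≡⟨ trans (ι-minus (+ 2 * z - + 2 * (q * + b)) (+ b)) (cong (Q._- ι (+ b)) (ι-minus (+ 2 * z) (+ 2 * (q * + b)))) ⟨
  ι (+ 2 * z - + 2 * (q * + b) - + b)
    ≡⟨ cong ι (trans (cong (λ w → + 2 * w - + 2 * (q * + b) - + b) (a≡a%ℕn+[a/ℕn]*n z b)) (lem (+ (z %ℕ b)) (q * + b) (+ b))) ⟩
  ι (c b z - 1ℤ) ∎
  where
  q = z /ℕ b
  expand : ∀ y Q h t B → (y Q.- Q Q.- h) Q.* (t Q.* B) ≡ t Q.* (y Q.* B) Q.- t Q.* (Q Q.* B) Q.- (h Q.* t) Q.* B
  expand = solve 5 (λ y Q h t B → (y :- Q :- h) :* (t :* B) := t :* (y :* B) :- t :* (Q :* B) :- (h :* t) :* B) refl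
    where open +-*-Solver
  lem : ∀ r u b → + 2 * (r + u) - + 2 * u - b ≡ + 2 * r - b + 1ℤ - 1ℤ
  lem = solve-∀

-- Here `p` is a common denominator; `sum1` counts from 1 and `∑` from 0, whence the shift of index.
sum1-ι : ∀ n f g p → (∀ k → suc k ≤ n → f (suc k) Q.* p ≡ ι (g k)) → sum1 n f Q.* p ≡ ι (∑ n g)
sum1-ι zero    f g p eq = Q.*-zeroˡ p
sum1-ι (suc n) f g p eq = begin
  (sum1 n f Q.+ f (suc n)) Q.* p            ≡⟨ Q.*-distribʳ-+ p (sum1 n f) (f (suc n)) ⟩
  sum1 n f Q.* p Q.+ f (suc n) Q.* p        ≡⟨ cong₂ Q._+_ (sum1-ι n f g p λ k k<n → eq k (ℕ.m≤n⇒m≤1+n k<n)) (eq n ℕ.≤-refl) ⟩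
  ι (∑ n g) Q.+ ι (g n)                     ≡⟨ ι-+ (∑ n g) (g n) ⟨
  ι (∑ n g + g n)                           ∎

-- Multiplying by the inverse `d` would make `b` divide `suc k`, although `0 < suc k < b`.
unit-%≢0 : ∀ b .{{_ : NonZero b}} a → Inverse a b → ∀ k → suc k < b → (a * + suc k) %ℕ b ≢ 0
unit-%≢0 b a (d , x , inv) k k<b eq = ℕ.0≢1+n (trans (sym zero-rem) (%ℕ-unique b (+ suc k) (suc k) 0ℤ k<b (lem₀ (+ suc k) (+ b))))
  where
  q = (a * + suc k) /ℕ b
  divisible : a * + suc k ≡ q * + b
  divisible = trans (a≡a%ℕn+[a/ℕn]*n (a * + suc k) b) (trans (cong (λ r → + r + q * + b) eq) (ℤ.+-identityˡ _))
  lem₀ : ∀ k b → k ≡ k + 0ℤ * b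
  lem₀ = solve-∀
  lem₁ : ∀ k x b → k ≡ (1ℤ + x * b) * k - x * b * k
  lem₁ = solve-∀
  lem₂ : ∀ a d k x b → a * d * k - x * b * k ≡ d * (a * k) - x * b * k
  lem₂ = solve-∀
  lem₃ : ∀ d q b x k → d * (q * b) - x * b * k ≡ + 0 + (d * q - x * k) * b
  lem₃ = solve-∀
  zero-rem : (+ suc k) %ℕ b ≡ 0
  zero-rem = %ℕ-unique b (+ suc k) 0 (d * q - x * + suc k) (ℕ.>-nonZero⁻¹ b) (begin
    + suc k                                         ≡⟨ lem₁ (+ suc k) x (+ b) ⟩
    (1ℤ + x * + b) * + suc k - x * + b * + suc k    ≡⟨ cong (λ w → w * + suc k - x * + b * + suc k) inv ⟨
    a * d * + suc k - x * + b * + suc k             ≡⟨ lem₂ a d (+ suc k) x (+ b) ⟩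
    d * (a * + suc k) - x * + b * + suc k           ≡⟨ cong (λ w → d * w - x * + b * + suc k) divisible ⟩
    d * (q * + b) - x * + b * + suc k               ≡⟨ lem₃ d q (+ b) x (+ suc k) ⟩
    + 0 + (d * q - x * + suc k) * + b               ∎)

-- For `0 < k < b` each term becomes `(c k - 1) (c (a k) - 1)`. Over all residues these products add
-- up to the correlation plus `b`, the linear terms cancelling; the residue 0 accounts for `b * b`
-- there but for nothing in `s`.
s-correlation : ∀ b .{{_ : NonZero b}} a → Inverse a b →
  s a b Q.* (ι (+ (2 ℕ.* b)) Q.* ι (+ (2 ℕ.* b))) ≡ ι (correlation b a + + b - + b * + b)
s-correlation b@(suc b-1) a inv = begin
  (sum1 b-1 f Q.+ f b) Q.* (u Q.* u)
    -- The term `k = b` vanishes because `saw 1ℚ` evaluates to `0ℚ`.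
    ≡⟨ cong (λ w → (sum1 b-1 f Q.+ saw w Q.* saw ((a * + b) / b)) Q.* (u Q.* u)) (n/n≡1 b) ⟩
  (sum1 b-1 f Q.+ 0ℚ Q.* saw ((a * + b) / b)) Q.* (u Q.* u)
    ≡⟨ cong (Q._* (u Q.* u)) (trans (cong (sum1 b-1 f Q.+_) (Q.*-zeroˡ (saw ((a * + b) / b)))) (Q.+-identityʳ (sum1 b-1 f))) ⟩
  sum1 b-1 f Q.* (u Q.* u)
    ≡⟨ sum1-ι b-1 f (g ∘ suc) (u Q.* u) term ⟩
  ι (∑ b-1 (g ∘ suc))
    ≡⟨ cong ι (+-cancelˡ (g 0) _ _ (trans (sym (∑-head b-1 g)) (trans total (cong (_+ (correlation b a + + b - + b * + b)) (sym g0))))) ⟩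
  ι (correlation b a + + b - + b * + b) ∎
  where
  f : ℕ → ℚ
  f k = saw (+ k / b) Q.* saw ((a * + k) / b)

  u : ℚ
  u = ι (+ (2 ℕ.* b))

  g : ℕ → ℤ
  g k = (c b (+ k) - 1ℤ) * (c b (a * + k) - 1ℤ)

  term : ∀ k → suc k ≤ b-1 → f (suc k) Q.* (u Q.* u) ≡ ι (g (suc k))
  term k k≤ = begin
    saw (+ suc k / b) Q.* saw ((a * + suc k) / b) Q.* (u Q.* u)
      ≡⟨ interchange (saw (+ suc k / b)) (saw ((a * + suc k) / b)) u ⟩
    (saw (+ suc k / b) Q.* u) Q.* (saw ((a * + suc k) / b) Q.* u)
      ≡⟨ cong₂ Q._*_ (saw-c b (+ suc k) small) (saw-c b (a * + suc k) (unit-%≢0 b a inv k (s≤s k≤))) ⟩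
    ι (c b (+ suc k) - 1ℤ) Q.* ι (c b (a * + suc k) - 1ℤ)
      ≡⟨ ι-* (c b (+ suc k) - 1ℤ) (c b (a * + suc k) - 1ℤ) ⟨
    ι (g (suc k)) ∎
    where
    interchange : ∀ p q u → p Q.* q Q.* (u Q.* u) ≡ (p Q.* u) Q.* (q Q.* u)
    interchange = solve 3 (λ p q u → p :* q :* (u :* u) := (p :* u) :* (q :* u)) refl
      where open +-*-Solver
    small : (+ suc k) %ℕ b ≢ 0
    small eq = unit-%≢0 b 1ℤ inverse-1 k (s≤s k≤) (trans (cong (_%ℕ b) (ℤ.*-identityˡ (+ suc k))) eq)

  c0 : c b 0ℤ - 1ℤ ≡ - + b
  c0 = trans (cong (_- 1ℤ) (c-small b 0 ℕ.z<s)) (lem (+ b))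
    where
    lem : ∀ b → + 2 * 0ℤ - b + 1ℤ - 1ℤ ≡ - b
    lem = solve-∀

  g0 : g 0 ≡ + b * + b
  g0 = trans (cong₂ _*_ c0 (trans (cong (λ z → c b z - 1ℤ) (ℤ.*-zeroʳ a)) c0)) (lem (+ b))
    where
    lem : ∀ b → - b * - b ≡ b * b
    lem = solve-∀

  total : ∑ b g ≡ + b * + b + (correlation b a + + b - + b * + b)
  total = begin
    ∑ b g
      ≡⟨ ∑-ext b (λ k → lem₁ (c b (+ k)) (c b (a * + k))) ⟩
    ∑ b (λ k → (c b (+ k) * c b (a * + k) + -1ℤ * c b (+ k)) + (-1ℤ * c b (a * + k) + 1ℤ))
      ≡⟨ trans (∑-+ b _ _) (cong₂ _+_
           (trans (∑-+ b _ _) (cong (_+_ (correlation b a)) (trans (∑-* b -1ℤ (λ k → c b (+ k))) (cong (-1ℤ *_) (∑-c b)))))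
           (trans (∑-+ b _ _) (cong₂ _+_ (trans (∑-* b -1ℤ (λ k → c b (a * + k))) (cong (-1ℤ *_) (∑-c-unit b a inv)))
             (∑-const b 1ℤ)))) ⟩
    (correlation b a + -1ℤ * 0ℤ) + (-1ℤ * 0ℤ + + b * 1ℤ)
      ≡⟨ lem₂ (correlation b a) (+ b) ⟩
    + b * + b + (correlation b a + + b - + b * + b) ∎
    where
    lem₁ : ∀ x y → (x - 1ℤ) * (y - 1ℤ) ≡ (x * y + -1ℤ * x) + (-1ℤ * y + 1ℤ)
    lem₁ = solve-∀
    lem₂ : ∀ e b → (e + -1ℤ * 0ℤ) + (-1ℤ * 0ℤ + b * 1ℤ) ≡ b * b + (e + b - b * b)
    lem₂ = solve-∀

-- Coprimality and inverses.

gcd≡1⇒inverse : ∀ a b → gcd a (+ b) ≡ 1ℤ → Inverse a b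
gcd≡1⇒inverse a b eq = signed a (natural ∣ a ∣ (coprime-Bézout (gcd≡1⇒coprime {∣ a ∣} {b} (ℤ.+-injective eq))))
  where
  cast : ∀ k l m n → 1 ℕ.+ k ℕ.* l ≡ m ℕ.* n → 1ℤ + + k * + l ≡ + m * + n
  cast k l m n eq = trans (cong (_+_ 1ℤ) (sym (ℤ.pos-* k l))) (trans (cong +_ eq) (ℤ.pos-* m n))

  natural : ∀ m → ℕ.Bézout.Identity 1 m b → Inverse (+ m) b
  natural m (ℕ.Bézout.+- x y eq) = + x , + y , trans (ℤ.*-comm (+ m) (+ x)) (sym (cast y b x m eq))
  natural m (ℕ.Bézout.-+ x y eq) = - + x , - + y ,
    trans (lem₁ (+ m) (+ x)) (trans (cong (λ w → 1ℤ - w) (cast x m y b eq)) (lem₂ (+ y) (+ b)))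
    where
    lem₁ : ∀ m x → m * - x ≡ 1ℤ - (1ℤ + x * m)
    lem₁ = solve-∀
    lem₂ : ∀ y b → 1ℤ - y * b ≡ 1ℤ + - y * b
    lem₂ = solve-∀

  signed : ∀ a → Inverse (+ ∣ a ∣) b → Inverse a b
  signed (+ m)    inv           = inv
  signed -[1+ m ] (d , x , eq) = - d , x , trans (lem (+ suc m) d) eq
    where
    lem : ∀ m d → - m * - d ≡ m * d
    lem = solve-∀

inverse⇒gcd≡1 : ∀ a b → Inverse a b → gcd a (+ b) ≡ 1ℤ
inverse⇒gcd≡1 a b (d , x , eq) = cong +_ (ℕ.∣1⇒≡1 (∣⇒∣ᵤ g∣1))
  where
  g = gcd a (+ b)
  lem : ∀ x b → 1ℤ + x * b + - x * b ≡ 1ℤ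
  lem = solve-∀
  g∣1 : g ∣ 1ℤ
  g∣1 = subst (g ∣_) (trans (cong (_+ - x * + b) eq) (lem x (+ b)))
    (∣m∣n⇒∣m+n (∣m⇒∣m*n {m = a} d (∣ᵤ⇒∣ (gcd[i,j]∣i a (+ b)))) (∣n⇒∣m*n (- x) {+ b} (∣ᵤ⇒∣ (gcd[i,j]∣j a (+ b)))))

-- The inflated pairs: coprimality, equal sums, growth.

module _ (b : ℕ) .{{_ : NonZero b}} (i : ℕ) where

  open Inflate b i

  -- a′, x′; b L, d′ are the entries of M Tⁱ M⁻¹ T⁻ⁱ M for M = (a, x; b, d), T = (1, 1; 0, 1), whose determinant is 1.
  inverse-inflate : ∀ a → Inverse a b → Inverse (a′ a) (b ℕ.* L)
  inverse-inflate a (d , x , inv) = d′ , x′ , (begin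
    (a * + L - N) * d′
      ≡⟨ cong (λ w → (a * w - N) * d′) +L ⟩
    (a * (1ℤ + N * N) - N) * d′
      ≡⟨ lem₁ a d (x * + b) N ⟩
    a * d - x * + b + (1ℤ + N * N) * ((1ℤ - N * a) * (x * + b) + N * (a * a - 1ℤ + N * a) * d)
      -- One factor `N` is expanded to `i b`, so that `b` splits off beside `L`.
      ≡⟨ cong₂ (λ v w → v - x * + b + (1ℤ + N * N) * ((1ℤ - N * a) * (x * + b) + w * (a * a - 1ℤ + N * a) * d)) inv +n ⟩
    1ℤ + x * + b - x * + b + (1ℤ + N * N) * ((1ℤ - N * a) * (x * + b) + + i * + b * (a * a - 1ℤ + N * a) * d)
      ≡⟨ cong₂ (λ v w → 1ℤ + x * + b - x * + b + v * w) (sym +L) (lem₂ (+ b) x a d (+ i) N) ⟩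
    1ℤ + x * + b - x * + b + + L * (x′ * + b)
      ≡⟨ lem₃ x (+ b) (+ L) x′ ⟩
    1ℤ + x′ * (+ b * + L)
      ≡⟨ cong (λ w → 1ℤ + x′ * w) (ℤ.pos-* b L) ⟨
    1ℤ + x′ * + (b ℕ.* L) ∎)
    where
    N = + n
    d′ = (1ℤ + N * a + N * N) * d - N * (x * + b)
    x′ = (1ℤ - N * a) * x + + i * (a * a - 1ℤ + N * a) * d
    lem₁ : ∀ a d y n → (a * (1ℤ + n * n) - n) * ((1ℤ + n * a + n * n) * d - n * y) ≡
           a * d - y + (1ℤ + n * n) * ((1ℤ - n * a) * y + n * (a * a - 1ℤ + n * a) * d)
    lem₁ = solve-∀
    lem₂ : ∀ b x a d i n → (1ℤ - n * a) * (x * b) + i * b * (a * a - 1ℤ + n * a) * d ≡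
           ((1ℤ - n * a) * x + i * (a * a - 1ℤ + n * a) * d) * b
    lem₂ = solve-∀
    lem₃ : ∀ x b L y → 1ℤ + x * b - x * b + L * (y * b) ≡ 1ℤ + y * (b * L)
    lem₃ = solve-∀

  -- After multiplication by `(2 b L)²` both sides are integers, and `correlation-inflate` makes the
  -- left one L² times the integer `E + b - b * b` belonging to `s a b`.
  s-inflate : ∀ a → Inverse a b → s (a′ a) (b ℕ.* L) ≡ s a b
  s-inflate a inv = ι-cancel (2 ℕ.* N) (ι-cancel (2 ℕ.* N) (begin
    s (a′ a) N Q.* u′ Q.* u′
      ≡⟨ Q.*-assoc (s (a′ a) N) u′ u′ ⟩
    s (a′ a) N Q.* (u′ Q.* u′)
      ≡⟨ s-correlation N (a′ a) (inverse-inflate a inv) ⟩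
    ι (correlation N (a′ a) + + N - + N * + N)
      ≡⟨ cong₂ (λ v w → ι (v + w - w * w)) (correlation-inflate a inv) (ℤ.pos-* b L) ⟩
    ι (+ L * + L * E + + b * (+ L * + L - + L) + + b * + L - + b * + L * (+ b * + L))
      ≡⟨ cong ι (lem (+ L) E (+ b)) ⟩
    ι ((E + + b - + b * + b) * (+ L * + L))
      ≡⟨ trans (ι-* (E + + b - + b * + b) (+ L * + L)) (cong₂ Q._*_ (sym (s-correlation b a inv)) (ι-* (+ L) (+ L))) ⟩
    s a b Q.* (u Q.* u) Q.* (ι (+ L) Q.* ι (+ L))
      ≡⟨ regroup (s a b) u (ι (+ L)) ⟩
    s a b Q.* (u Q.* ι (+ L)) Q.* (u Q.* ι (+ L))
      ≡⟨ cong (λ w → s a b Q.* w Q.* w) u′≡ ⟨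
    s a b Q.* u′ Q.* u′ ∎))
    where
    N = b ℕ.* L
    E = correlation b a
    u u′ : ℚ
    u = ι (+ (2 ℕ.* b))
    u′ = ι (+ (2 ℕ.* N))
    instance
      2N≢0 : NonZero (2 ℕ.* N)
      2N≢0 = ℕ.m*n≢0 2 N
    u′≡ : u′ ≡ u Q.* ι (+ L)
    u′≡ = trans (cong (ι ∘ +_) (sym (ℕ.*-assoc 2 b L))) (trans (cong ι (ℤ.pos-* (2 ℕ.* b) L)) (ι-* (+ (2 ℕ.* b)) (+ L)))
    lem : ∀ L e b → L * L * e + b * (L * L - L) + b * L - b * L * (b * L) ≡ (e + b - b * b) * (L * L)
    lem = solve-∀
    regroup : ∀ p u v → p Q.* (u Q.* u) Q.* (v Q.* v) ≡ p Q.* (u Q.* v) Q.* (u Q.* v)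
    regroup = solve 3 (λ p u v → p :* (u :* u) :* (v :* v) := p :* (u :* v) :* (u :* v)) refl
      where open +-*-Solver

  -- The chain is `i ≤ i b = n < L ≤ b L`; it makes the denominators tend to infinity.
  index≤modulus : i ≤ b ℕ.* L
  index≤modulus = ℕ.≤-trans (ℕ.m≤m*n i b) (ℕ.≤-trans (ℕ.<⇒≤ n<L) (ℕ.m≤n*m L b))

theorem1 : (r : ℚ) →
    (Σ ℤ λ a → Σ ℕ λ b → Σ (NonZero b) λ nz →
    gcd a (+ b) ≡ 1ℤ × S a b {{nz}} ≡ r) →
    Σ (ℕ → ℤ) λ A → Σ (ℕ → ℕ) λ B → Σ ((i : ℕ) → NonZero (B i)) λ nz →
    ((i : ℕ) → gcd (A i) (+ B i) ≡ 1ℤ) ×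
    ((M : ℕ) → Σ ℕ λ N → (i : ℕ) → N ≤ i → M ≤ B i) ×
    ((i : ℕ) → S (A i) (B i) {{nz i}} ≡ r)
theorem1 r (a , b , nz , coprime , S≡r) =
  (λ i → a′ i a) , (λ i → b ℕ.* L i) , (λ i → bL-nonZero i) ,
  (λ i → inverse⇒gcd≡1 (a′ i a) (b ℕ.* L i) (inverse-inflate b i a inv)) ,
  (λ M → M , λ i M≤i → ℕ.≤-trans M≤i (index≤modulus b i)) ,
  λ i → trans (cong ((+ 12 / 1) Q.*_) (s-inflate b i a inv)) S≡r
  where
  instance _ = nz
  open Inflate b
  inv = gcd≡1⇒inverse a b coprime
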